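{- There is no formula $A$ of $\mathbf{L_1}$ such that both $\vdash_H A$ and $\dashv_H A$.
   Context: Formulas of $\mathbf{L_1}$: built from atomic formulas $\epsilon ab$ ($a,b$ name variables, possibly equal) with primitive connectives $\vee,\sim$; $\wedge,\supset,\equiv$ defined as usual. Disjunctions may be associated in any way. $\vdash_H A$: $A$ belongs to the smallest set containing all instances of classical propositional tautologies and all formulas $\epsilon ab\supset\epsilon aa$, $(\epsilon ab\wedge\epsilon bc)\supset\epsilon ac$, $(\epsilon ab\wedge\epsilon bb)\supset\epsilon ba$, closed under modus ponens. Positive/negative parts (occurrences): $A$ is a positive part of $A$; if $B\vee C$ is a positive part then $B,C$ are positive parts; if $\sim B$ is a positive part then $B$ is a negative part; if $\sim B$ is a negative part then $B$ is a positive part. $F[B_+,B_-]$ denotes a formula in which some $B$ has one occurrence as positive part and another non-overlapping occurrence as negative part. Hintikka formula: a formula $H$ such that (1) $H$ is not of the form $F[B_+,B_-]$; (2) if $B\vee C$ is a negative part of $H$ then $B$ or $C$ is; (3) if $\epsilon ab$ is a negative part then so is $\epsilon aa$; (4) if $\epsilon ab,\epsilon bc$ are negative parts then so is $\epsilon ac$; (5) if $\epsilon ab,\epsilon bb$ are negative parts then so is $\epsilon ba$. $\mathbf{HAR}$: fix a name variable $a_0$; $\dashv_H$ is the smallest set such that $\dashv_H\epsilon a_0a_0$; $\dashv_H\sim\epsilon a_0a_0$; if $\vdash_H A\supset B$ and $\dashv_H B$ then $\dashv_H A$; if $\dashv_H A$ and $A$ is obtained from $B$ by uniform substitution of name variables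 for name variables then $\dashv_H B$; if $A$ is a Hintikka formula that is a disjunction of atomic or negated atomic formulas, $\dashv_H A$, and $\epsilon ab$ is not a negative part of $A$, then $\dashv_H A\vee\epsilon ab$. -}

module Defs where

open import Data.Bool.Base as Bool using (Bool; true; not)
open import Data.List.Base using (List; []; _∷_)
open import Data.List.Relation.Binary.Suffix.Heterogeneous using (Suffix)
open import Data.Nat.Base using (ℕ)
open import Data.Product.Base using (_×_; _,_; ∃-syntax)
open import Data.Sum.Base using (_⊎_)
open import Relation.Binary.PropositionalEquality.Core using (_≡_)
open import Relation.Nullary.Negation.Core using (¬_)

infix  8 ∼_
infixr 7 _∧_
infixr 6 _∨_
infixr 5 _⊃_

-- Formulas over an arbitrary set of atoms, so that L₁ and the language of
-- propositional logic (used to state "instance of a tautology") share one type.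
data Form (X : Set) : Set where
  atom : X → Form X
  _∨_  : Form X → Form X → Form X
  ∼_   : Form X → Form X

_∧_ _⊃_ _≣_ : {X : Set} → Form X → Form X → Form X
A ∧ B = ∼ (∼ A ∨ ∼ B)
A ⊃ B = ∼ A ∨ B
A ≣ B = (A ⊃ B) ∧ (B ⊃ A)

_>>=_ : {X Y : Set} → Form X → (X → Form Y) → Form Y
atom x  >>= σ = σ x
(A ∨ B) >>= σ = (A >>= σ) ∨ (B >>= σ)
(∼ A)   >>= σ = ∼ (A >>= σ)

Name : Set
Name = ℕ

Formula : Set
Formula = Form (Name × Name)

ε : Name → Name → Formula
ε a b = atom (a , b)

rename : (Name → Name) → Formula → Formula
rename σ A = A >>= λ (a , b) → ε (σ a) (σ b)

eval : {X : Set} → (X → Bool) → Form X → Bool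
eval v (atom x) = v x
eval v (A ∨ B)  = eval v A Bool.∨ eval v B
eval v (∼ A)    = not (eval v A)

Tautology : Form ℕ → Set
Tautology P = ∀ v → eval v P ≡ true

infix 4 ⊢H_

data ⊢H_ : Formula → Set where
  taut : (P : Form ℕ) → Tautology P → (σ : ℕ → Formula) → ⊢H (P >>= σ)
  ax₁  : ∀ a b → ⊢H (ε a b ⊃ ε a a)
  ax₂  : ∀ a b c → ⊢H (ε a b ∧ ε b c ⊃ ε a c)
  ax₃  : ∀ a b → ⊢H (ε a b ∧ ε b b ⊃ ε b a)
  mp   : ∀ {A B} → ⊢H (A ⊃ B) → ⊢H A → ⊢H B

data Sign : Set where
  pos neg : Sign

data Step : Set where
  left right under : Step

-- The steps leading from an occurrence up to the root of the whole formula
-- (innermost step first).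
Position : Set
Position = List Step

-- PartAt A s p B: the occurrence of B at position p in A is a part of A of
-- sign s.  A negative disjunction is not decomposed.
data PartAt (A : Formula) : Sign → Position → Formula → Set where
  root : PartAt A pos [] A
  ∨-l  : ∀ {p B C} → PartAt A pos p (B ∨ C) → PartAt A pos (left ∷ p) B
  ∨-r  : ∀ {p B C} → PartAt A pos p (B ∨ C) → PartAt A pos (right ∷ p) C
  ∼-⁺  : ∀ {p B} → PartAt A pos p (∼ B) → PartAt A neg (under ∷ p) B
  ∼-⁻  : ∀ {p B} → PartAt A neg p (∼ B) → PartAt A pos (under ∷ p) B

NegPart : Formula → Formula → Set
NegPart A B = ∃[ p ] PartAt A neg p B

-- Two subformula occurrences overlap iff one lies inside the other, i.e. iff
-- the position of one is a suffix of the position of the other.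
NonOverlapping : Position → Position → Set
NonOverlapping p q = ¬ Suffix _≡_ p q × ¬ Suffix _≡_ q p

-- A is of the form F[B₊,B₋] for some B.
Clashing : Formula → Set
Clashing A = ∃[ B ] ∃[ p ] ∃[ q ]
  PartAt A pos p B × PartAt A neg q B × NonOverlapping p q

record Hintikka (H : Formula) : Set where
  field
    no-clash : ¬ Clashing H
    disj     : ∀ B C → NegPart H (B ∨ C) → NegPart H B ⊎ NegPart H C
    refl-ε   : ∀ a b → NegPart H (ε a b) → NegPart H (ε a a)
    trans-ε  : ∀ a b c → NegPart H (ε a b) → NegPart H (ε b c) → NegPart H (ε a c)
    sym-ε    : ∀ a b → NegPart H (ε a b) → NegPart H (ε b b) → NegPart H (ε b a)

-- Disjunctions of literals, with one or more disjuncts associated in any way.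
data LiteralDisjunction : Formula → Set where
  positive : ∀ a b → LiteralDisjunction (ε a b)
  negative : ∀ a b → LiteralDisjunction (∼ ε a b)
  _or_     : ∀ {A B} → LiteralDisjunction A → LiteralDisjunction B → LiteralDisjunction (A ∨ B)

infix 4 ⊣H[_]_

data ⊣H[_]_ (a₀ : Name) : Formula → Set where
  rej-ε  : ⊣H[ a₀ ] ε a₀ a₀
  rej-∼ε : ⊣H[ a₀ ] ∼ ε a₀ a₀
  rej-mp : ∀ {A B} → ⊢H (A ⊃ B) → ⊣H[ a₀ ] B → ⊣H[ a₀ ] A
  rej-sb : ∀ (σ : Name → Name) B → ⊣H[ a₀ ] rename σ B → ⊣H[ a₀ ] B
  rej-∨  : ∀ {A} a b → Hintikka A → LiteralDisjunction A → ⊣H[ a₀ ] A →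
           ¬ NegPart A (ε a b) → ⊣H[ a₀ ] (A ∨ ε a b)

{-# OPTIONS --safe #-}

-- Call a valuation of the atoms a model if it satisfies the three axioms of
-- L₁.  Provable formulas are true in every model, while every rejected formula
-- is false in some model: for A ∨ ε a b with A Hintikka, take the atoms
-- occurring as negative parts of A to be exactly the true ones.
module Submission where

open import Data.Bool.Base as Bool using (Bool; true; false; not)
open import Data.List.Base using (List; []; [_]; _++_)
open import Data.List.Membership.Propositional using (_∈_)
open import Data.List.Membership.Propositional.Properties using (∈-++⁺ˡ; ∈-++⁺ʳ; ∈-++⁻)
open import Data.List.Relation.Binary.Pointwise using (Pointwise-≡⇒≡)
open import Data.List.Relation.Binary.Suffix.Heterogeneous using (Suffix; here; there)
open import Data.List.Relation.Unary.Any using (here)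
open import Data.Nat.Properties using (_≟_)
open import Data.Product.Base using (_×_; _,_; ∃-syntax)
open import Data.Product.Properties using (≡-dec)
open import Data.Sum.Base using (inj₁; inj₂)
open import Function.Base using (_∘_; id)
open import Relation.Binary.PropositionalEquality using (_≡_; refl; sym; trans; cong; cong₂)
open import Relation.Nullary.Decidable using (yes; does; dec-true; dec-false)
open import Relation.Nullary.Negation.Core using (¬_; contradiction)
import Data.List.Membership.DecPropositional as DecMembership
open import Defs

open DecMembership (≡-dec _≟_ _≟_) using (_∈?_)

Atom : Set
Atom = Name × Name

record IsModel (v : Atom → Bool) : Set where
  field
    v-refl  : ∀ a b → v (a , b) ≡ true → v (a , a) ≡ true
    v-trans : ∀ a b c → v (a , b) ≡ true → v (b , c) ≡ true → v (a , c) ≡ true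
    v-sym   : ∀ a b → v (a , b) ≡ true → v (b , b) ≡ true → v (b , a) ≡ true

Refutable : Formula → Set
Refutable A = ∃[ v ] IsModel v × eval v A ≡ false

-- Serves both uses of `_>>=_`: instances of tautologies in `soundness`, and renamings of names in
-- the rejection rule `rej-sb`.
eval->>= : {X Y : Set} (v : Y → Bool) (P : Form X) (σ : X → Form Y) →
           eval v (P >>= σ) ≡ eval (eval v ∘ σ) P
eval->>= v (atom x) σ = refl
eval->>= v (P ∨ Q)  σ = cong₂ Bool._∨_ (eval->>= v P σ) (eval->>= v Q σ)
eval->>= v (∼ P)    σ = cong not (eval->>= v P σ)

not-∨-intro : ∀ x y → (x ≡ true → y ≡ true) → not x Bool.∨ y ≡ true
not-∨-intro true  y h = h refl
not-∨-intro false y h = refl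

not-∨-elim : ∀ {x y} → not x Bool.∨ y ≡ true → x ≡ true → y ≡ true
not-∨-elim h refl = h

-- The shape to which evaluation reduces a conjunction.
not-∨-not-elim : ∀ x y → not (not x Bool.∨ not y) ≡ true → x ≡ true × y ≡ true
not-∨-not-elim true  true  h = refl , refl
not-∨-not-elim true  false ()
not-∨-not-elim false y     ()

soundness : ∀ {v A} → IsModel v → ⊢H A → eval v A ≡ true
soundness {v} m (taut P t σ) = trans (eval->>= v P σ) (t (eval v ∘ σ))
soundness m (ax₁ a b) = not-∨-intro _ _ (IsModel.v-refl m a b)
soundness m (ax₂ a b c) = not-∨-intro _ _ λ h →
  let ab , bc = not-∨-not-elim _ _ h in IsModel.v-trans m a b c ab bc
soundness m (ax₃ a b) = not-∨-intro _ _ λ h →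
  let ab , bb = not-∨-not-elim _ _ h in IsModel.v-sym m a b ab bb
soundness m (mp A⊃B A) = not-∨-elim (soundness m A⊃B) (soundness m A)

-- Signs are compared along with formulas because the step `under` does not reveal whether `∼-⁺` or
-- `∼-⁻` was used; the induction hypothesis excludes the mixed cases by their signs.
PartAt-functional : ∀ {A s t p B C} → PartAt A s p B → PartAt A t p C → (s , B) ≡ (t , C)
PartAt-functional root root = refl
PartAt-functional (∨-l x) (∨-l y) with refl ← PartAt-functional x y = refl
PartAt-functional (∨-r x) (∨-r y) with refl ← PartAt-functional x y = refl
PartAt-functional (∼-⁺ x) (∼-⁺ y) with refl ← PartAt-functional x y = refl
PartAt-functional (∼-⁺ x) (∼-⁻ y) with () ← PartAt-functional x y
PartAt-functional (∼-⁻ x) (∼-⁺ y) with () ← PartAt-functional x y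
PartAt-functional (∼-⁻ x) (∼-⁻ y) with refl ← PartAt-functional x y = refl

-- Atoms have no proper subformulas: were `q` strictly below `p`, induction on the parent of `q`
-- would identify the atom with a disjunction or a negation.
parts-within-atom : ∀ {A s t p q x C} → PartAt A s p (atom x) → PartAt A t q C →
                    Suffix _≡_ p q → (s , atom x) ≡ (t , C)
parts-within-atom x y (here p≗q) with refl ← Pointwise-≡⇒≡ p≗q = PartAt-functional x y
parts-within-atom x (∨-l y) (there p⊑q) with () ← parts-within-atom x y p⊑q
parts-within-atom x (∨-r y) (there p⊑q) with () ← parts-within-atom x y p⊑q
parts-within-atom x (∼-⁺ y) (there p⊑q) with () ← parts-within-atom x y p⊑q
parts-within-atom x (∼-⁻ y) (there p⊑q) with () ← parts-within-atom x y p⊑q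

-- For atoms non-overlapping is automatic, since nested occurrences would coincide and so have the
-- same sign.
atom-clash : ∀ {A p q x} → PartAt A pos p (atom x) → PartAt A neg q (atom x) → Clashing A
atom-clash x⁺ x⁻ = _ , _ , _ , x⁺ , x⁻ ,
  (λ p⊑q → contradiction (parts-within-atom x⁺ x⁻ p⊑q) λ ()) ,
  (λ q⊑p → contradiction (parts-within-atom x⁻ x⁺ q⊑p) λ ())

-- A list makes membership decidable, so that the negative parts can define a Boolean valuation.
negatedAtoms : ∀ {A} → LiteralDisjunction A → List Atom
negatedAtoms (positive a b) = []
negatedAtoms (negative a b) = [ (a , b) ]
negatedAtoms (d or e)       = negatedAtoms d ++ negatedAtoms e

∈-negatedAtoms⁻ : ∀ {H A p x} (d : LiteralDisjunction A) → PartAt H pos p A →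
                  x ∈ negatedAtoms d → NegPart H (atom x)
∈-negatedAtoms⁻ (negative a b) A⁺ (here refl) = _ , ∼-⁺ A⁺
∈-negatedAtoms⁻ (d or e) A⁺ x∈ with ∈-++⁻ (negatedAtoms d) x∈
... | inj₁ x∈d = ∈-negatedAtoms⁻ d (∨-l A⁺) x∈d
... | inj₂ x∈e = ∈-negatedAtoms⁻ e (∨-r A⁺) x∈e

mutual
  -- Literal disjunctions are closed under positive parts, and negative parts arise only from
  -- negated atoms. The inclusion of atom lists carries each such atom back up to the whole formula.
  posPart-literals : ∀ {A p B} (d : LiteralDisjunction A) → PartAt A pos p B →
    ∃[ e ] (∀ {x} → x ∈ negatedAtoms {B} e → x ∈ negatedAtoms d)
  posPart-literals d root = d , id
  posPart-literals d (∨-l B∨C) with posPart-literals d B∨C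
  ... | e or f , ⊆d = e , ⊆d ∘ ∈-++⁺ˡ
  posPart-literals d (∨-r B∨C) with posPart-literals d B∨C
  ... | e or f , ⊆d = f , ⊆d ∘ ∈-++⁺ʳ (negatedAtoms e)
  -- A negative part is an atom, hence never a negation.
  posPart-literals d (∼-⁻ ∼B) with negPart-literals d ∼B
  ... | _ , () , _

  negPart-literals : ∀ {A p B} (d : LiteralDisjunction A) → PartAt A neg p B →
    ∃[ x ] B ≡ atom x × x ∈ negatedAtoms d
  negPart-literals d (∼-⁺ ∼B) with posPart-literals d ∼B
  ... | negative a b , ⊆d = (a , b) , refl , ⊆d (here refl)

∈-negatedAtoms⁺ : ∀ {A x} (d : LiteralDisjunction A) → NegPart A (atom x) → x ∈ negatedAtoms d
∈-negatedAtoms⁺ d (_ , x⁻) with negPart-literals d x⁻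
... | _ , refl , x∈d = x∈d

module NegPartModel {H} (hintikka : Hintikka H) (d : LiteralDisjunction H) where
  open Hintikka hintikka

  val : Atom → Bool
  val x = does (x ∈? negatedAtoms d)

  val-true⁺ : ∀ {x} → NegPart H (atom x) → val x ≡ true
  val-true⁺ {x} x⁻ = dec-true (x ∈? negatedAtoms d) (∈-negatedAtoms⁺ d x⁻)

  val-true⁻ : ∀ {x} → val x ≡ true → NegPart H (atom x)
  val-true⁻ {x} h with yes x∈ ← x ∈? negatedAtoms d = ∈-negatedAtoms⁻ d root x∈

  val-false : ∀ {x} → ¬ NegPart H (atom x) → val x ≡ false
  val-false {x} ¬x⁻ = dec-false (x ∈? negatedAtoms d) (¬x⁻ ∘ ∈-negatedAtoms⁻ d root)

  -- Clauses (3) to (5) of the Hintikka conditions, read through the equivalence of `val` with being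
  -- a negative part.
  isModel : IsModel val
  isModel = record
    { v-refl  = λ a b ab → val-true⁺ (refl-ε a b (val-true⁻ ab))
    ; v-trans = λ a b c ab bc → val-true⁺ (trans-ε a b c (val-true⁻ ab) (val-true⁻ bc))
    ; v-sym   = λ a b ab bb → val-true⁺ (sym-ε a b (val-true⁻ ab) (val-true⁻ bb))
    }

  -- A positive atom that were true would also be a negative part, which is a clash; a negated atom
  -- is false because its atom is a negative part.
  posPart-false : ∀ {p A} → LiteralDisjunction A → PartAt H pos p A → eval val A ≡ false
  posPart-false (positive a b) A⁺ = val-false λ (_ , A⁻) → no-clash (atom-clash A⁺ A⁻)
  posPart-false (negative a b) A⁺ = cong not (val-true⁺ (_ , ∼-⁺ A⁺))
  posPart-false (e or f)       A⁺ =
    cong₂ Bool._∨_ (posPart-false e (∨-l A⁺)) (posPart-false f (∨-r A⁺))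

const-isModel : ∀ x → IsModel (λ _ → x)
const-isModel x = record
  { v-refl  = λ _ _ h → h
  ; v-trans = λ _ _ _ h _ → h
  ; v-sym   = λ _ _ h _ → h
  }

rename-isModel : ∀ {v} (σ : Name → Name) → IsModel v → IsModel (λ (a , b) → v (σ a , σ b))
rename-isModel σ m = record
  { v-refl  = λ a b → v-refl (σ a) (σ b)
  ; v-trans = λ a b c → v-trans (σ a) (σ b) (σ c)
  ; v-sym   = λ a b → v-sym (σ a) (σ b)
  } where open IsModel m

not-∨-false : ∀ x {y} → not x Bool.∨ y ≡ true → y ≡ false → x ≡ false
not-∨-false false h refl = refl

rejected⇒refutable : ∀ {a₀ A} → ⊣H[ a₀ ] A → Refutable A
rejected⇒refutable rej-ε  = (λ _ → false) , const-isModel false , refl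
rejected⇒refutable rej-∼ε = (λ _ → true) , const-isModel true , refl
rejected⇒refutable (rej-mp A⊃B ⊣B) =
  let v , m , B-false = rejected⇒refutable ⊣B
  in v , m , not-∨-false _ (soundness m A⊃B) B-false
rejected⇒refutable (rej-sb σ B ⊣σB) =
  let v , m , σB-false = rejected⇒refutable ⊣σB
  -- The witness is `v` pulled back along `σ`: it gives `B` the value that `v` gives the renamed
  -- formula.
  in _ , rename-isModel σ m , trans (sym (eval->>= v B _)) σB-false
rejected⇒refutable (rej-∨ a b hintikka d _ ¬ab⁻) =
  -- The model is built from `A` afresh, not taken from its rejection; the side condition on `ε a b`
  -- makes the new disjunct false in it.
  val , isModel , cong₂ Bool._∨_ (posPart-false d root) (val-false ¬ab⁻)
  where open NegPartModel hintikka d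

theorem6p4 : (a₀ : Name) → ¬ (∃[ A ] (⊢H A × ⊣H[ a₀ ] A))
theorem6p4 a₀ (A , ⊢A , ⊣A) with rejected⇒refutable ⊣A
... | v , m , A-false = contradiction (trans (sym (soundness m ⊢A)) A-false) λ ()
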